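{- Let $\mathcal M$ be a monoidal category, let $\mathcal C,\mathcal D$ be $\mathcal M$-actegories and let $\Gamma:\mathcal C\to\mathcal D$ be a lax $\mathcal M$-equivariant functor. Then the gluing category $\mathcal D\downarrow\Gamma$ is an $\mathcal M$-actegory (i.e. it carries an $\mathcal M$-action) such that the projection functor $\pi:(\mathcal D\downarrow\Gamma)\to\mathcal C$ is strict $\mathcal M$-equivariant.
   Context: Let $(\mathcal M,\otimes,I)$ be a monoidal category. An $\mathcal M$-action on a category $\mathcal C$ is a bifunctor $(-)\cdot(-):\mathcal M\times\mathcal C\to\mathcal C$ with natural isomorphisms $\eta_c:I\cdot c\to c$ and $\mu_{m_1,m_2,c}:(m_1\otimes m_2)\cdot c\to m_1\cdot(m_2\cdot c)$ such that (suppressing associators) $\mu_{m_1,m_2,m_3\cdot c}\circ\mu_{m_1\otimes m_2,m_3,c}=(\mathrm{id}\cdot\mu_{m_2,m_3,c})\circ\mu_{m_1,m_2\otimes m_3,c}$ and $(\mathrm{id}_m\cdot\eta_c)\circ\mu_{m,I,c}=r_m\cdot\mathrm{id}_c$, with $r_m:m\otimes I\to m$ the right unitor. An $\mathcal M$-actegory is a category with an $\mathcal M$-action. A functor $F:\mathcal C\to\mathcal D$ between $\mathcal M$-actegories is lax $\mathcal M$-equivariant if it is equipped with a natural transformation $\phi_{m,c}:m\cdot Fc\to F(m\cdot c)$ such that $F\mu_{m,m',c}\circ\phi_{m\otimes m',c}=\phi_{m,m'\cdot c}\circ(\mathrm{id}\cdot\phi_{m',c})\circ\mu_{m,m',Fc}$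 and $F\eta_c\circ\phi_{I,c}=\eta_{Fc}$. It is strong if $\phi$ is an isomorphism and strict if $\phi$ is the identity. The gluing category $\mathcal D\downarrow\Gamma$ is the comma category of $\mathrm{Id}_{\mathcal D}$ over $\Gamma$: objects are triples $(D,C,f:D\to\Gamma C)$; morphisms $(D,C,f)\to(D',C',f')$ are pairs $(d:D\to D',c:C\to C')$ with $f'\circ d=\Gamma c\circ f$. The projection is $\pi(D,C,f)=C$. -}

module Defs where

open import Level using (Level; _⊔_; suc)
open import Data.Product using (_×_; _,_; proj₁; proj₂)
open import Relation.Binary using (Rel; IsEquivalence; Setoid)
import Relation.Binary.Reasoning.Setoid as SetoidReasoning

private
  variable
    o ℓ e o′ ℓ′ e′ o″ ℓ″ e″ : Level

-- Categories are setoid-enriched: equality of parallel morphisms is the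
-- equivalence relation _≈_.
record Category (o ℓ e : Level) : Set (suc (o ⊔ ℓ ⊔ e)) where
  infix  4 _≈_ _⇒_
  infixr 9 _∘_
  field
    Obj : Set o
    _⇒_ : Rel Obj ℓ
    _≈_ : ∀ {A B} → Rel (A ⇒ B) e
    id  : ∀ {A} → A ⇒ A
    _∘_ : ∀ {A B C} → B ⇒ C → A ⇒ B → A ⇒ C

    equiv     : ∀ {A B} → IsEquivalence (_≈_ {A} {B})
    assoc     : ∀ {A B C D} {f : A ⇒ B} {g : B ⇒ C} {h : C ⇒ D} →
                (h ∘ g) ∘ f ≈ h ∘ (g ∘ f)
    identityˡ : ∀ {A B} {f : A ⇒ B} → id ∘ f ≈ f
    identityʳ : ∀ {A B} {f : A ⇒ B} → f ∘ id ≈ f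
    ∘-resp-≈  : ∀ {A B C} {f f′ : B ⇒ C} {g g′ : A ⇒ B} →
                f ≈ f′ → g ≈ g′ → f ∘ g ≈ f′ ∘ g′

  module Equiv {A B : Obj} = IsEquivalence (equiv {A} {B})

  hom-setoid : (A B : Obj) → Setoid ℓ e
  hom-setoid A B = record { isEquivalence = equiv {A} {B} }

  infix 4 _≅_
  record _≅_ (A B : Obj) : Set (ℓ ⊔ e) where
    field
      to   : A ⇒ B
      from : B ⇒ A
      isoˡ : from ∘ to ≈ id
      isoʳ : to ∘ from ≈ id

  -- "f is an identity morphism".  The constructor only applies when domain and
  -- codomain are the same object, so for f : A ⇒ B this includes A ≡ B.
  data IsIdentity {A : Obj} : ∀ {B} → A ⇒ B → Set (o ⊔ ℓ ⊔ e) where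
    is-id : {f : A ⇒ A} → f ≈ id → IsIdentity f

record Functor (C : Category o ℓ e) (D : Category o′ ℓ′ e′) :
               Set (o ⊔ ℓ ⊔ e ⊔ o′ ⊔ ℓ′ ⊔ e′) where
  private
    module C = Category C
    module D = Category D
  field
    F₀ : C.Obj → D.Obj
    F₁ : ∀ {A B} → A C.⇒ B → F₀ A D.⇒ F₀ B

    F-resp-≈     : ∀ {A B} {f g : A C.⇒ B} → f C.≈ g → F₁ f D.≈ F₁ g
    identity     : ∀ {A} → F₁ (C.id {A}) D.≈ D.id
    homomorphism : ∀ {A B X} {f : A C.⇒ B} {g : B C.⇒ X} →
                   F₁ (g C.∘ f) D.≈ F₁ g D.∘ F₁ f

Product : Category o ℓ e → Category o′ ℓ′ e′ →
          Category (o ⊔ o′) (ℓ ⊔ ℓ′) (e ⊔ e′)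
Product C D = record
  { Obj       = C.Obj × D.Obj
  ; _⇒_       = λ (A , X) (B , Y) → (A C.⇒ B) × (X D.⇒ Y)
  ; _≈_       = λ (f , h) (g , k) → (f C.≈ g) × (h D.≈ k)
  ; id        = C.id , D.id
  ; _∘_       = λ (g , k) (f , h) → (g C.∘ f) , (k D.∘ h)
  ; equiv     = record
    { refl  = C.Equiv.refl , D.Equiv.refl
    ; sym   = λ (p , q) → C.Equiv.sym p , D.Equiv.sym q
    ; trans = λ (p , q) (p′ , q′) → C.Equiv.trans p p′ , D.Equiv.trans q q′
    }
  ; assoc     = C.assoc , D.assoc
  ; identityˡ = C.identityˡ , D.identityˡ
  ; identityʳ = C.identityʳ , D.identityʳ
  ; ∘-resp-≈  = λ (p , q) (p′ , q′) → C.∘-resp-≈ p p′ , D.∘-resp-≈ q q′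
  }
  where
    module C = Category C
    module D = Category D

record MonoidalCategory (o ℓ e : Level) : Set (suc (o ⊔ ℓ ⊔ e)) where
  field
    category : Category o ℓ e
  open Category category public
  open _≅_
  field
    ⊗    : Functor (Product category category) category
    unit : Obj

  infixr 10 _⊗₀_ _⊗₁_
  _⊗₀_ : Obj → Obj → Obj
  A ⊗₀ B = Functor.F₀ ⊗ (A , B)

  _⊗₁_ : ∀ {A B A′ B′} → A ⇒ A′ → B ⇒ B′ → A ⊗₀ B ⇒ A′ ⊗₀ B′
  f ⊗₁ g = Functor.F₁ ⊗ (f , g)

  field
    unitorˡ    : ∀ A → unit ⊗₀ A ≅ A
    unitorʳ    : ∀ A → A ⊗₀ unit ≅ A
    associator : ∀ A B C → (A ⊗₀ B) ⊗₀ C ≅ A ⊗₀ (B ⊗₀ C)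

  l : ∀ A → unit ⊗₀ A ⇒ A
  l A = to (unitorˡ A)

  r : ∀ A → A ⊗₀ unit ⇒ A
  r A = to (unitorʳ A)

  α : ∀ A B C → (A ⊗₀ B) ⊗₀ C ⇒ A ⊗₀ (B ⊗₀ C)
  α A B C = to (associator A B C)

  field
    l-natural : ∀ {A A′} (f : A ⇒ A′) → l A′ ∘ (id ⊗₁ f) ≈ f ∘ l A
    r-natural : ∀ {A A′} (f : A ⇒ A′) → r A′ ∘ (f ⊗₁ id) ≈ f ∘ r A
    α-natural : ∀ {A A′ B B′ C C′} (f : A ⇒ A′) (g : B ⇒ B′) (h : C ⇒ C′) →
                α A′ B′ C′ ∘ ((f ⊗₁ g) ⊗₁ h) ≈ (f ⊗₁ (g ⊗₁ h)) ∘ α A B C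

    triangle  : ∀ A B → (id ⊗₁ l B) ∘ α A unit B ≈ r A ⊗₁ id
    pentagon  : ∀ A B C D →
                (id ⊗₁ α B C D) ∘ α A (B ⊗₀ C) D ∘ (α A B C ⊗₁ id)
                ≈ α A B (C ⊗₀ D) ∘ α (A ⊗₀ B) C D

-- An actegory is a category C together with an element of Action M C.
record Action (M : MonoidalCategory o ℓ e) (C : Category o′ ℓ′ e′) :
              Set (o ⊔ ℓ ⊔ e ⊔ o′ ⊔ ℓ′ ⊔ e′) where
  private
    module M = MonoidalCategory M
  open Category C
  open M using (_⊗₀_; _⊗₁_)
  open _≅_
  field
    act : Functor (Product M.category C) C

  infixr 10 _·_ _·₁_
  _·_ : M.Obj → Obj → Obj
  m · c = Functor.F₀ act (m , c)

  _·₁_ : ∀ {m m′ c c′} → m M.⇒ m′ → c ⇒ c′ → m · c ⇒ m′ · c′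
  f ·₁ h = Functor.F₁ act (f , h)

  field
    η-iso : ∀ c → M.unit · c ≅ c
    μ-iso : ∀ m₁ m₂ c → (m₁ ⊗₀ m₂) · c ≅ m₁ · (m₂ · c)

  η : ∀ c → M.unit · c ⇒ c
  η c = to (η-iso c)

  μ : ∀ m₁ m₂ c → (m₁ ⊗₀ m₂) · c ⇒ m₁ · (m₂ · c)
  μ m₁ m₂ c = to (μ-iso m₁ m₂ c)

  field
    η-natural : ∀ {c c′} (h : c ⇒ c′) → η c′ ∘ (M.id ·₁ h) ≈ h ∘ η c
    μ-natural : ∀ {m₁ m₁′ m₂ m₂′ c c′}
                (f : m₁ M.⇒ m₁′) (g : m₂ M.⇒ m₂′) (h : c ⇒ c′) →
                μ m₁′ m₂′ c′ ∘ ((f ⊗₁ g) ·₁ h) ≈ (f ·₁ (g ·₁ h)) ∘ μ m₁ m₂ c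

    μ-assoc   : ∀ m₁ m₂ m₃ c →
                μ m₁ m₂ (m₃ · c) ∘ μ (m₁ ⊗₀ m₂) m₃ c
                ≈ (M.id ·₁ μ m₂ m₃ c) ∘ μ m₁ (m₂ ⊗₀ m₃) c ∘ (M.α m₁ m₂ m₃ ·₁ id)
    μ-unit    : ∀ m c → (M.id ·₁ η c) ∘ μ m M.unit c ≈ M.r m ·₁ id

module Actegory {M : MonoidalCategory o ℓ e} {C : Category o′ ℓ′ e′}
                (A : Action M C) where
  open Category C public
  open Action A public

record LaxEquivariant {M : MonoidalCategory o ℓ e}
                      {C : Category o′ ℓ′ e′} {D : Category o″ ℓ″ e″}
                      (AC : Action M C) (AD : Action M D) (F : Functor C D) :
                      Set (o ⊔ ℓ ⊔ e ⊔ o′ ⊔ ℓ′ ⊔ e′ ⊔ o″ ⊔ ℓ″ ⊔ e″) where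
  private
    module M = MonoidalCategory M
    module C = Actegory AC
    module D = Actegory AD
  open M using (_⊗₀_)
  open D using (_∘_; _≈_)
  open Functor F
  field
    φ         : ∀ m c → m D.· F₀ c D.⇒ F₀ (m C.· c)
    φ-natural : ∀ {m m′ c c′} (f : m M.⇒ m′) (h : c C.⇒ c′) →
                φ m′ c′ ∘ (f D.·₁ F₁ h) ≈ F₁ (f C.·₁ h) ∘ φ m c
    φ-μ       : ∀ m m′ c →
                F₁ (C.μ m m′ c) ∘ φ (m ⊗₀ m′) c
                ≈ φ m (m′ C.· c) ∘ (M.id D.·₁ φ m′ c) ∘ D.μ m m′ (F₀ c)
    φ-η       : ∀ c → F₁ (C.η c) ∘ φ M.unit c ≈ D.η (F₀ c)

record StrictEquivariant {M : MonoidalCategory o ℓ e}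
                         {C : Category o′ ℓ′ e′} {D : Category o″ ℓ″ e″}
                         (AC : Action M C) (AD : Action M D) (F : Functor C D) :
                         Set (o ⊔ ℓ ⊔ e ⊔ o′ ⊔ ℓ′ ⊔ e′ ⊔ o″ ⊔ ℓ″ ⊔ e″) where
  field
    lax : LaxEquivariant AC AD F
  open LaxEquivariant lax public
  field
    φ-identity : ∀ m c → Category.IsIdentity D (φ m c)

module _ {C : Category o ℓ e} {D : Category o′ ℓ′ e′} (Γ : Functor C D) where
  private
    module C = Category C
    module D = Category D
  open D using (_∘_; _≈_; assoc; ∘-resp-≈; module Equiv)
  open Functor Γ renaming (F₀ to Γ₀; F₁ to Γ₁)

  record GluingObj : Set (o ⊔ o′ ⊔ ℓ′) where
    constructor gobj
    field
      dom : D.Obj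
      cod : C.Obj
      arr : dom D.⇒ Γ₀ cod
  open GluingObj

  record GluingHom (X Y : GluingObj) : Set (ℓ ⊔ ℓ′ ⊔ e′) where
    constructor ghom
    field
      homᴰ   : dom X D.⇒ dom Y
      homᶜ   : cod X C.⇒ cod Y
      square : arr Y ∘ homᴰ ≈ Γ₁ homᶜ ∘ arr X
  open GluingHom

  private
    id-square : ∀ X → arr X ∘ D.id ≈ Γ₁ C.id ∘ arr X
    id-square X = begin
      arr X ∘ D.id     ≈⟨ D.identityʳ ⟩
      arr X            ≈⟨ D.identityˡ ⟨
      D.id ∘ arr X     ≈⟨ ∘-resp-≈ identity Equiv.refl ⟨
      Γ₁ C.id ∘ arr X  ∎
      where open SetoidReasoning (D.hom-setoid (dom X) (Γ₀ (cod X)))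

    ∘-square : ∀ {X Y Z} (h : GluingHom Y Z) (k : GluingHom X Y) →
               arr Z ∘ (homᴰ h ∘ homᴰ k) ≈ Γ₁ (homᶜ h C.∘ homᶜ k) ∘ arr X
    ∘-square {X} {Y} {Z} h k = begin
      arr Z ∘ (homᴰ h ∘ homᴰ k)             ≈⟨ assoc ⟨
      (arr Z ∘ homᴰ h) ∘ homᴰ k             ≈⟨ ∘-resp-≈ (square h) Equiv.refl ⟩
      (Γ₁ (homᶜ h) ∘ arr Y) ∘ homᴰ k        ≈⟨ assoc ⟩
      Γ₁ (homᶜ h) ∘ (arr Y ∘ homᴰ k)        ≈⟨ ∘-resp-≈ Equiv.refl (square k) ⟩
      Γ₁ (homᶜ h) ∘ (Γ₁ (homᶜ k) ∘ arr X)   ≈⟨ assoc ⟨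
      (Γ₁ (homᶜ h) ∘ Γ₁ (homᶜ k)) ∘ arr X   ≈⟨ ∘-resp-≈ homomorphism Equiv.refl ⟨
      Γ₁ (homᶜ h C.∘ homᶜ k) ∘ arr X        ∎
      where open SetoidReasoning (D.hom-setoid (dom X) (Γ₀ (cod Z)))

  Gluing : Category (o ⊔ o′ ⊔ ℓ′) (ℓ ⊔ ℓ′ ⊔ e′) (e ⊔ e′)
  Gluing = record
    { Obj       = GluingObj
    ; _⇒_       = GluingHom
    ; _≈_       = λ h k → (homᴰ h ≈ homᴰ k) × (homᶜ h C.≈ homᶜ k)
    ; id        = λ {X} → ghom D.id C.id (id-square X)
    ; _∘_       = λ h k →
                  ghom (homᴰ h ∘ homᴰ k) (homᶜ h C.∘ homᶜ k) (∘-square h k)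
    ; equiv     = record
      { refl  = Equiv.refl , C.Equiv.refl
      ; sym   = λ (p , q) → Equiv.sym p , C.Equiv.sym q
      ; trans = λ (p , q) (p′ , q′) → Equiv.trans p p′ , C.Equiv.trans q q′
      }
    ; assoc     = assoc , C.assoc
    ; identityˡ = D.identityˡ , C.identityˡ
    ; identityʳ = D.identityʳ , C.identityʳ
    ; ∘-resp-≈  = λ (p , q) (p′ , q′) → ∘-resp-≈ p p′ , C.∘-resp-≈ q q′
    }

  π : Functor Gluing C
  π = record
    { F₀           = cod
    ; F₁           = homᶜ
    ; F-resp-≈     = proj₂
    ; identity     = C.Equiv.refl
    ; homomorphism = C.Equiv.refl
    }

infix 5 _↓_
_↓_ : {C : Category o ℓ e} (D : Category o′ ℓ′ e′) (Γ : Functor C D) →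
      Category (o ⊔ o′ ⊔ ℓ′) (ℓ ⊔ ℓ′ ⊔ e′) (e ⊔ e′)
D ↓ Γ = Gluing Γ

{-# OPTIONS --safe #-}
-- The action on the gluing category is
--   m · (D , C , f) = (m · D , m · C , φ ∘ (id · f)),
-- and its structure maps are the pairs of structure maps of the two actions.
-- The coherence laws of Φ say exactly that these pairs are morphisms of D ↓ Γ;
-- all equations then hold componentwise.
module Submission where

open import Defs
open import Level using (Level)
open import Data.Product using (Σ-syntax; _,_)
import Relation.Binary.Reasoning.Setoid as SetoidReasoning

private
  variable
    o ℓ e o′ ℓ′ e′ o″ ℓ″ e″ : Level

module ActionProperties {M : MonoidalCategory o ℓ e} {C : Category o′ ℓ′ e′}
                        (A : Action M C) where
  private
    module M = MonoidalCategory M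
  open Actegory A
  open Functor act

  -- Bifunctoriality with the unit law of `M` absorbed into `f`. This rule and the next let a
  -- morphism `f` of `M` travel with either factor of a composite in the second variable.
  id·-∘ : ∀ {m m′ c c′ c″} {f : m M.⇒ m′} {h : c′ ⇒ c″} {k : c ⇒ c′} →
          (M.id ·₁ h) ∘ (f ·₁ k) ≈ f ·₁ (h ∘ k)
  id·-∘ = Equiv.trans (Equiv.sym homomorphism)
                      (F-resp-≈ (M.identityˡ , Equiv.refl))

  ∘-id· : ∀ {m m′ c c′ c″} {f : m M.⇒ m′} {h : c′ ⇒ c″} {k : c ⇒ c′} →
          (f ·₁ h) ∘ (M.id ·₁ k) ≈ f ·₁ (h ∘ k)
  ∘-id· = Equiv.trans (Equiv.sym homomorphism)
                      (F-resp-≈ (M.identityʳ , Equiv.refl))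

  -- Naturality of `μ` in its last variable alone; the `M.id ⊗₁ M.id` that appears is collapsed
  -- because `⊗` preserves identities.
  μ-naturalʳ : ∀ {m m′ c c′} (h : c ⇒ c′) →
               (M.id ·₁ (M.id ·₁ h)) ∘ μ m m′ c ≈ μ m m′ c′ ∘ (M.id ·₁ h)
  μ-naturalʳ h = Equiv.trans
    (Equiv.sym (μ-natural M.id M.id h))
    (∘-resp-≈ Equiv.refl
      (F-resp-≈ (Functor.identity M.⊗ , Equiv.refl)))

module GluingProperties {C : Category o ℓ e} {D : Category o′ ℓ′ e′}
                        (Γ : Functor C D) where
  private
    module C = Category C
    module D = Category D
  open D using (_∘_; _≈_; assoc; ∘-resp-≈; module Equiv)
  open Functor Γ renaming (F₀ to Γ₀; F₁ to Γ₁)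
  open GluingObj

  -- Conjugation of the given square by the two inverses: `Γ` preserves the isomorphism `j`, so
  -- `Γ₁ J.from` cancels `Γ₁ J.to` on the left while `I.from` cancels `I.to` on the right.
  ≅-inverse-square :
    ∀ {X Y : GluingObj Γ} (i : dom X D.≅ dom Y) (j : cod X C.≅ cod Y) →
    arr Y ∘ D._≅_.to i ≈ Γ₁ (C._≅_.to j) ∘ arr X →
    arr X ∘ D._≅_.from i ≈ Γ₁ (C._≅_.from j) ∘ arr Y
  ≅-inverse-square {X} {Y} i j square = begin
    arr X ∘ I.from
      ≈⟨ ∘-resp-≈ D.identityˡ Equiv.refl ⟨
    (D.id ∘ arr X) ∘ I.from
      ≈⟨ ∘-resp-≈ (∘-resp-≈ identity Equiv.refl) Equiv.refl ⟨
    (Γ₁ C.id ∘ arr X) ∘ I.from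
      ≈⟨ ∘-resp-≈ (∘-resp-≈ (F-resp-≈ J.isoˡ) Equiv.refl) Equiv.refl ⟨
    (Γ₁ (J.from C.∘ J.to) ∘ arr X) ∘ I.from
      ≈⟨ ∘-resp-≈ (∘-resp-≈ homomorphism Equiv.refl) Equiv.refl ⟩
    ((Γ₁ J.from ∘ Γ₁ J.to) ∘ arr X) ∘ I.from
      ≈⟨ ∘-resp-≈ assoc Equiv.refl ⟩
    (Γ₁ J.from ∘ (Γ₁ J.to ∘ arr X)) ∘ I.from
      ≈⟨ ∘-resp-≈ (∘-resp-≈ Equiv.refl square) Equiv.refl ⟨
    (Γ₁ J.from ∘ (arr Y ∘ I.to)) ∘ I.from
      ≈⟨ assoc ⟩
    Γ₁ J.from ∘ ((arr Y ∘ I.to) ∘ I.from)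
      ≈⟨ ∘-resp-≈ Equiv.refl assoc ⟩
    Γ₁ J.from ∘ (arr Y ∘ (I.to ∘ I.from))
      ≈⟨ ∘-resp-≈ Equiv.refl (∘-resp-≈ Equiv.refl I.isoʳ) ⟩
    Γ₁ J.from ∘ (arr Y ∘ D.id)
      ≈⟨ ∘-resp-≈ Equiv.refl D.identityʳ ⟩
    Γ₁ J.from ∘ arr Y
      ∎
    where
    module I = D._≅_ i
    module J = C._≅_ j
    open SetoidReasoning (D.hom-setoid (dom Y) (Γ₀ (cod X)))

  -- Reduces an isomorphism of `D ↓ Γ` to its forward square. The inverse laws are inherited because
  -- equality of gluing morphisms compares components only.
  gluing-≅ : ∀ {X Y : GluingObj Γ} (i : dom X D.≅ dom Y) (j : cod X C.≅ cod Y) →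
             arr Y ∘ D._≅_.to i ≈ Γ₁ (C._≅_.to j) ∘ arr X →
             Category._≅_ (D ↓ Γ) X Y
  gluing-≅ i j square = record
    { to   = ghom I.to J.to square
    ; from = ghom I.from J.from (≅-inverse-square i j square)
    ; isoˡ = I.isoˡ , J.isoˡ
    ; isoʳ = I.isoʳ , J.isoʳ
    }
    where
    module I = D._≅_ i
    module J = C._≅_ j

module GluingAction {M : MonoidalCategory o ℓ e}
                    {C : Category o′ ℓ′ e′} {D : Category o″ ℓ″ e″}
                    {AC : Action M C} {AD : Action M D} {Γ : Functor C D}
                    (Φ : LaxEquivariant AC AD Γ) where
  private
    module M = MonoidalCategory M
    module C = Actegory AC
    module D = Actegory AD
    module FC = Functor C.act
    module FD = Functor D.act
  open M using (_⊗₀_)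
  open D using (_∘_; _≈_; assoc; ∘-resp-≈; module Equiv)
  open Functor Γ renaming (F₀ to Γ₀; F₁ to Γ₁)
  open LaxEquivariant Φ
  open ActionProperties AD
  open GluingProperties Γ
  open GluingObj
  open GluingHom

  infixr 10 _·_
  _·_ : M.Obj → GluingObj Γ → GluingObj Γ
  m · X = gobj (m D.· dom X) (m C.· cod X) (φ m (cod X) ∘ (M.id D.·₁ arr X))

  ·₁-square : ∀ {m m′ X Y} (f : m M.⇒ m′) (h : GluingHom Γ X Y) →
              arr (m′ · Y) ∘ (f D.·₁ homᴰ h) ≈ Γ₁ (f C.·₁ homᶜ h) ∘ arr (m · X)
  ·₁-square {m} {m′} {X} {Y} f h = begin
    (φ m′ (cod Y) ∘ (M.id D.·₁ arr Y)) ∘ (f D.·₁ homᴰ h)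
      ≈⟨ assoc ⟩
    φ m′ (cod Y) ∘ ((M.id D.·₁ arr Y) ∘ (f D.·₁ homᴰ h))
      ≈⟨ ∘-resp-≈ Equiv.refl id·-∘ ⟩
    φ m′ (cod Y) ∘ (f D.·₁ (arr Y ∘ homᴰ h))
      ≈⟨ ∘-resp-≈ Equiv.refl (FD.F-resp-≈ (M.Equiv.refl , square h)) ⟩
    φ m′ (cod Y) ∘ (f D.·₁ (Γ₁ (homᶜ h) ∘ arr X))
      -- Splitting on the other side moves `f` from `arr Y` to `Γ₁ (homᶜ h)`, which is the form in
      -- which naturality of `φ` applies.
      ≈⟨ ∘-resp-≈ Equiv.refl ∘-id· ⟨
    φ m′ (cod Y) ∘ ((f D.·₁ Γ₁ (homᶜ h)) ∘ (M.id D.·₁ arr X))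
      ≈⟨ assoc ⟨
    (φ m′ (cod Y) ∘ (f D.·₁ Γ₁ (homᶜ h))) ∘ (M.id D.·₁ arr X)
      ≈⟨ ∘-resp-≈ (φ-natural f (homᶜ h)) Equiv.refl ⟩
    (Γ₁ (f C.·₁ homᶜ h) ∘ φ m (cod X)) ∘ (M.id D.·₁ arr X)
      ≈⟨ assoc ⟩
    Γ₁ (f C.·₁ homᶜ h) ∘ (φ m (cod X) ∘ (M.id D.·₁ arr X))
      ∎
    where open SetoidReasoning (D.hom-setoid (m D.· dom X) (Γ₀ (m′ C.· cod Y)))

  -- Naturality of `D.η` at `arr X`, followed by the unit law of `φ`.
  η-square : ∀ X → arr X ∘ D.η (dom X) ≈ Γ₁ (C.η (cod X)) ∘ arr (M.unit · X)
  η-square X = begin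
    arr X ∘ D.η (dom X)
      ≈⟨ D.η-natural (arr X) ⟨
    D.η (Γ₀ (cod X)) ∘ (M.id D.·₁ arr X)
      ≈⟨ ∘-resp-≈ (φ-η (cod X)) Equiv.refl ⟨
    (Γ₁ (C.η (cod X)) ∘ φ M.unit (cod X)) ∘ (M.id D.·₁ arr X)
      ≈⟨ assoc ⟩
    Γ₁ (C.η (cod X)) ∘ (φ M.unit (cod X) ∘ (M.id D.·₁ arr X))
      ∎
    where open SetoidReasoning (D.hom-setoid (M.unit D.· dom X) (Γ₀ (cod X)))

  -- Once the two copies of `φ` are separated from `arr X`, the square is the law `φ-μ` at `cod X`
  -- precomposed with `M.id D.·₁ arr X`.
  μ-square : ∀ m m′ X →
             arr (m · m′ · X) ∘ D.μ m m′ (dom X)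
             ≈ Γ₁ (C.μ m m′ (cod X)) ∘ arr ((m ⊗₀ m′) · X)
  μ-square m m′ X = begin
    (φ₁ ∘ (M.id D.·₁ (φ₂ ∘ (M.id D.·₁ arr X)))) ∘ D.μ m m′ (dom X)
      ≈⟨ assoc ⟩
    φ₁ ∘ ((M.id D.·₁ (φ₂ ∘ (M.id D.·₁ arr X))) ∘ D.μ m m′ (dom X))
      ≈⟨ ∘-resp-≈ Equiv.refl (∘-resp-≈ id·-∘ Equiv.refl) ⟨
    φ₁ ∘ (((M.id D.·₁ φ₂) ∘ (M.id D.·₁ (M.id D.·₁ arr X))) ∘ D.μ m m′ (dom X))
      ≈⟨ ∘-resp-≈ Equiv.refl assoc ⟩
    φ₁ ∘ ((M.id D.·₁ φ₂) ∘ ((M.id D.·₁ (M.id D.·₁ arr X)) ∘ D.μ m m′ (dom X)))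
      -- `D.μ` slides past `arr X` and now sits at `Γ₀ (cod X)`, next to the two copies of `φ`.
      ≈⟨ ∘-resp-≈ Equiv.refl (∘-resp-≈ Equiv.refl (μ-naturalʳ (arr X))) ⟩
    φ₁ ∘ ((M.id D.·₁ φ₂) ∘ (D.μ m m′ (Γ₀ (cod X)) ∘ (M.id D.·₁ arr X)))
      ≈⟨ ∘-resp-≈ Equiv.refl assoc ⟨
    φ₁ ∘ (((M.id D.·₁ φ₂) ∘ D.μ m m′ (Γ₀ (cod X))) ∘ (M.id D.·₁ arr X))
      ≈⟨ assoc ⟨
    (φ₁ ∘ ((M.id D.·₁ φ₂) ∘ D.μ m m′ (Γ₀ (cod X)))) ∘ (M.id D.·₁ arr X)
      ≈⟨ ∘-resp-≈ (φ-μ m m′ (cod X)) Equiv.refl ⟨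
    (Γ₁ (C.μ m m′ (cod X)) ∘ φ (m ⊗₀ m′) (cod X)) ∘ (M.id D.·₁ arr X)
      ≈⟨ assoc ⟩
    Γ₁ (C.μ m m′ (cod X)) ∘ (φ (m ⊗₀ m′) (cod X) ∘ (M.id D.·₁ arr X))
      ∎
    where
    φ₁ = φ m (m′ C.· cod X)
    φ₂ = φ m′ (cod X)
    open SetoidReasoning
      (D.hom-setoid ((m ⊗₀ m′) D.· dom X) (Γ₀ (m C.· m′ C.· cod X)))

  gluing-action : Action M (D ↓ Γ)
  gluing-action = record
    { act       = record
      { F₀           = λ (m , X) → m · X
      ; F₁           = λ (f , h) →
                       ghom (f D.·₁ homᴰ h) (f C.·₁ homᶜ h) (·₁-square f h)
      ; F-resp-≈     = λ (p , (q , q′)) →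
                       FD.F-resp-≈ (p , q) , FC.F-resp-≈ (p , q′)
      ; identity     = FD.identity , FC.identity
      ; homomorphism = FD.homomorphism , FC.homomorphism
      }
    ; η-iso     = λ X →
                  gluing-≅ (D.η-iso (dom X)) (C.η-iso (cod X)) (η-square X)
    ; μ-iso     = λ m m′ X →
                  gluing-≅ (D.μ-iso m m′ (dom X)) (C.μ-iso m m′ (cod X))
                           (μ-square m m′ X)
    ; η-natural = λ h → D.η-natural (homᴰ h) , C.η-natural (homᶜ h)
    ; μ-natural = λ f g h →
                  D.μ-natural f g (homᴰ h) , C.μ-natural f g (homᶜ h)
    ; μ-assoc   = λ m₁ m₂ m₃ X →
                  D.μ-assoc m₁ m₂ m₃ (dom X) , C.μ-assoc m₁ m₂ m₃ (cod X)
    ; μ-unit    = λ m X → D.μ-unit m (dom X) , C.μ-unit m (cod X)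
    }

  -- `cod (m · X)` is `m C.· cod X` by definition, so the identity of `C` is a well-typed choice of
  -- `φ`, and `is-id` applies to it.
  π-strict : StrictEquivariant gluing-action AC (π Γ)
  π-strict = record
    { lax        = record
      { φ         = λ m X → C.id
      ; φ-natural = λ f h →
                    C.Equiv.trans C.identityˡ (C.Equiv.sym C.identityʳ)
      -- Both sides reduce to `C.μ`; on the right, `FC.identity` first turns `M.id C.·₁ C.id` into
      -- an identity.
      ; φ-μ       = λ m m′ X → C.Equiv.trans C.identityʳ (C.Equiv.sym
                    (C.Equiv.trans C.identityˡ
                      (C.Equiv.trans
                        (C.∘-resp-≈ FC.identity C.Equiv.refl) C.identityˡ)))
      ; φ-η       = λ X → C.identityʳ
      }
    ; φ-identity = λ m X → C.is-id C.Equiv.refl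
    }

proposition20 : ∀ {oM ℓM eM oC ℓC eC oD ℓD eD : Level}
    (M : MonoidalCategory oM ℓM eM)
    (C : Category oC ℓC eC) (AC : Action M C)
    (D : Category oD ℓD eD) (AD : Action M D)
    (Γ : Functor C D) (Φ : LaxEquivariant AC AD Γ) →
    Σ[ A ∈ Action M (D ↓ Γ) ] StrictEquivariant A AC (π Γ)
proposition20 M C AC D AD Γ Φ = gluing-action , π-strict
  where open GluingAction Φ
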